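{- Let $n$ be a positive integer and $q = 2^n$. Let $L_{A_n}$ be the set of leaves of $G_q$ contained in $A_n$, and let $$S_{q+1} := \{\alpha \in \mathbb{F}_q^* : D_{q+1}(\alpha) = D_{q+1}(\alpha^{ -1}) = 0\}.$$ Then $L_{A_n}$ is not empty and $S_{q+1} = L_{A_n}$.
   Context: $D_m(x) = \sum_{i=0}^{\lfloor m/2 \rfloor} \frac{m}{m-i}\binom{m-i}{i}(-1)^i x^{m-2i} \in \mathbb{F}_q[x]$ is the Dickson polynomial of the first kind of degree $m>0$ with parameter $1$ (the integer coefficients being reduced mod $2$); it satisfies $D_m(x+x^{ -1}) = x^m + x^{ -m}$. The map $\theta$ on $\mathbf{P}^1(\mathbb{F}_q) = \mathbb{F}_q \cup \{\infty\}$ is defined by $\theta(0) = \theta(\infty) = \infty$ and $\theta(x) = x + x^{ -1}$ otherwise. $G_q$ is the directed graph with vertex set $\mathbf{P}^1(\mathbb{F}_q)$ and an arrow from $\alpha$ to $\theta(\alpha)$ for each vertex $\alpha$. A leaf of $G_q$ is a vertex with no incoming arrow, i.e. not of the form $\theta(x)$ with $x \in \mathbf{P}^1(\mathbb{F}_q)$. $\mathrm{Tr}_n(x) = \sum_{j=0}^{n-1} x^{2^j}$ is the absolute trace on $\mathbb{F}_{2^n}$, and $A_n := \{\alpha \in \mathbb{F}_q^* : \mathrm{Tr}_n(\alpha) = \mathrm{Tr}_n(\alpha^{ -1})\} \cup \{0, \infty\}$. -}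

module Defs where

open import Algebra.Bundles using (CommutativeRing)
open import Data.Empty.Polymorphic using (⊥)
open import Data.Fin.Base using (Fin; toℕ)
import Data.Fin.Properties as Fin
open import Data.Nat.Base as ℕ using (ℕ; suc; NonZero; ⌊_/2⌋; _∸_)
open import Data.Nat.Combinatorics using (_C_)
import Data.Nat.DivMod as ℕ
import Data.Nat.Properties as ℕ
open import Data.Product.Base using (Σ-syntax; ∃-syntax; _×_; proj₁)
open import Data.Sum.Base using (_⊎_)
open import Data.Unit.Polymorphic using (⊤)
open import Function.Bundles using (Inverse)
open import Function.Properties.Inverse using (Inverse⇒Injection)
open import Level using (Level; _⊔_) renaming (suc to lsuc)
import Relation.Binary.Construct.Add.Point.Equality as PointEquality
open import Relation.Binary.Core using (Rel)
open import Relation.Binary.Definitions using (Decidable)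
import Relation.Binary.PropositionalEquality as ≡
open import Relation.Nullary.Construct.Add.Point using (Pointed; ∙; [_])
open import Relation.Nullary.Decidable using (yes; no; via-injection)
open import Relation.Nullary.Negation using (¬_)
open import Relation.Unary using (Pred; _∩_)

record FiniteField (q : ℕ) (c ℓ : Level) : Set (lsuc (c ⊔ ℓ)) where
  field
    commutativeRing : CommutativeRing c ℓ

  open CommutativeRing commutativeRing public

  field
    0≉1         : 0# ≉ 1#
    invertible  : ∀ x → x ≉ 0# → ∃[ y ] x * y ≈ 1#
    cardinality : Inverse setoid (≡.setoid (Fin q))

  infix 4 _≟_

  _≟_ : Decidable _≈_
  _≟_ = via-injection (Inverse⇒Injection cardinality) Fin._≟_

  inv : ∀ x → x ≉ 0# → Carrier
  inv x x≉0 = proj₁ (invertible x x≉0)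

m∸i-nonZero : ∀ m .{{_ : NonZero m}} (i : Fin (suc ⌊ m /2⌋)) → NonZero (m ∸ toℕ i)
m∸i-nonZero (suc m) i =
  ℕ.>-nonZero (ℕ.m<n⇒0<n∸m (ℕ.≤-<-trans (Fin.toℕ≤pred[n] i) (ℕ.⌊n/2⌋<n m)))

-- The absolute value m/(m-i) · C(m-i, i) of a Dickson coefficient.  The
-- division is exact: for i ≥ 1 the quotient is C(m-i, i) + C(m-i-1, i-1).
dicksonCoeff : ∀ m .{{_ : NonZero m}} → Fin (suc ⌊ m /2⌋) → ℕ
dicksonCoeff m i =
  ℕ._/_ (m ℕ.* ((m ∸ toℕ i) C toℕ i)) (m ∸ toℕ i) {{m∸i-nonZero m i}}

module _ {c ℓ : Level} {q : ℕ} (F : FiniteField q c ℓ) where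

  open FiniteField F
  open import Algebra.Properties.CommutativeMonoid.Sum +-commutativeMonoid using (sum-syntax)
  open import Algebra.Properties.Semiring.Exp semiring using (_^_)
  open import Algebra.Properties.Semiring.Mult semiring using () renaming (_×_ to _·_)
  open PointEquality _≈_ using (_≈∙_)

  -- The value at x of the m-th Dickson polynomial of the first kind with
  -- parameter 1; k · y is the k-fold sum of y, so the integer coefficients
  -- are read in the prime field.
  D : ∀ m .{{_ : NonZero m}} → Carrier → Carrier
  D m x = ∑[ i < suc ⌊ m /2⌋ ]
            (dicksonCoeff m i · ((- 1#) ^ toℕ i * x ^ (m ∸ 2 ℕ.* toℕ i)))

  Tr : ℕ → Carrier → Carrier
  Tr n x = ∑[ j < n ] (x ^ (2 ℕ.^ toℕ j))

  -- The added point ∙ is ∞.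
  P¹ : Set c
  P¹ = Pointed Carrier

  θ : P¹ → P¹
  θ ∙     = ∙
  θ [ x ] with x ≟ 0#
  ... | yes _   = ∙
  ... | no  x≉0 = [ x + inv x x≉0 ]

  -- The arrows of the graph G_q on P¹.
  _⟶_ : Rel P¹ (c ⊔ ℓ)
  α ⟶ β = θ α ≈∙ β

  Leaf : Pred P¹ (c ⊔ ℓ)
  Leaf α = ¬ (∃[ β ] β ⟶ α)

  A : ℕ → Pred P¹ ℓ
  A n ∙     = ⊤
  A n [ x ] = x ≈ 0# ⊎ (Σ[ x≉0 ∈ x ≉ 0# ] Tr n x ≈ Tr n (inv x x≉0))

  L : ℕ → Pred P¹ (c ⊔ ℓ)
  L n = Leaf ∩ A n

  S : ∀ m .{{_ : NonZero m}} → Pred P¹ ℓ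
  S m ∙     = ⊥
  S m [ x ] = Σ[ x≉0 ∈ x ≉ 0# ] (D m x ≈ 0# × D m (inv x x≉0) ≈ 0#)

{-# OPTIONS --safe #-}

-- In characteristic 2 the identity D_{m+k} D_k = D_{m+2k} + D_m gives
-- D_{2^(k+1)+1}(x) = x^(2^k) D_{2^k+1}(x) + x, whence
--   D_{q+1}(x) = x² (1 + Tr_n(1/x))   for x ≠ 0.
-- On the other hand x = β + 1/β amounts to z² + z = 1/x² with z = β/x, so by
-- additive Hilbert 90 x is a leaf exactly when Tr_n(1/x) = 1.  Hence both sets
-- consist of the x ≠ 0 with Tr_n(x) = Tr_n(1/x) = 1.  Such an x exists because
-- Tr_n(x) · x^(q/2) Tr_n(1/x) is a monic polynomial of degree q - 1, which
-- cannot vanish on all of the field.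
module Submission where

open import Defs
open import Algebra.Bundles using (CommutativeMonoid; CommutativeRing)
import Algebra.Properties.CommutativeMonoid.Sum as MonoidSum
import Algebra.Properties.Group as GroupProperties
import Algebra.Properties.Semiring.Sum as SemiringSum
import Algebra.Solver.Ring as RingSolver
open import Algebra.Solver.Ring.AlmostCommutativeRing using (fromCommutativeRing; _-Raw-AlmostCommutative⟶_)
open import Data.Bool.Base using (Bool; true; false; if_then_else_)
import Data.Bool.Properties as Bool
open import Data.Fin.Base using (Fin; zero; suc; toℕ; cast; punchIn)
open import Data.Fin.Permutation using (Permutation; permutation)
import Data.Fin.Properties as Fin
open import Data.Maybe.Base using (just; nothing)
open import Data.Nat.Base as ℕ using (ℕ; zero; suc; NonZero; ⌊_/2⌋)
open import Data.Nat.Combinatorics using (_C_; nC1≡n; nCk+nC[k+1]≡[n+1]C[k+1])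
open import Data.Nat.Combinatorics.Specification using (k>n⇒nCk≡0)
open import Data.Nat.DivMod using (_/_; m*n/n≡m; /-congˡ)
import Data.Nat.Properties as ℕ
open import Data.Nat.Solver using (module +-*-Solver)
open import Data.Product.Base using (∃-syntax; _×_; _,_; proj₂)
open import Data.Sum.Base using (_⊎_; inj₁; inj₂)
open import Function.Base using (_∘_; _$_)
open import Function.Bundles using (Inverse)
open import Level using (_⊔_)
import Relation.Binary.Construct.Add.Point.Equality as PointEquality
open import Relation.Binary.Definitions using (WeaklyDecidable)
open import Relation.Binary.PropositionalEquality as ≡ using (_≡_; _≢_)
open import Relation.Nullary.Construct.Add.Point using (∙; [_])
open import Relation.Nullary.Decidable using (yes; no; decidable-stable)
open import Relation.Nullary.Negation using (¬_; contradiction)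
open import Relation.Unary using (Satisfiable; _≐_)

-- Characteristic 2 and x^q = x are not assumed: both come from the cardinality alone, by reindexing
-- the sum of all elements along a translation and the product of the nonzero ones along a
-- multiplication. The coefficient m/(m-i) · C(m-i, i) is a quotient of natural numbers whose
-- divisor may be even, so it cannot be evaluated in the field. It is first identified, over the
-- natural numbers, with an entry of a table that obeys a recurrence in m; only then is it carried
-- to the field, where the table yields the recurrence of the D_m. Traces satisfy T² = T, so for a
-- trace "nonzero" and "equal to 1" are the same. This lets a statement about a nonvanishing product
-- deliver two traces equal to 1. The count is tight: the two factors have degrees q/2 and q/2 - 1,
-- one less in total than the number of elements. The element so found serves twice: it shows that
-- the set of leaves is not empty, and it is the element of trace 1 that Hilbert 90 requires in the
-- equality of the two sets.

module _ where

  open import Data.Nat.Base using (_+_; _*_; _∸_; _≤_; _<_; s≤s; z≤n; s<s)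
  open import Data.Nat.Properties
  open ≡ using (refl; sym; trans; cong; cong₂; subst; module ≡-Reasoning)

  -- Binomial identities and the integer coefficients of the Dickson polynomials

  [k+1]*[n+1]C[k+1]≡[n+1]*nCk : ∀ n k → suc k * (suc n C suc k) ≡ suc n * (n C k)
  [k+1]*[n+1]C[k+1]≡[n+1]*nCk n zero =
    trans (*-identityˡ _) (trans (nC1≡n (suc n)) (sym (*-identityʳ (suc n))))
  [k+1]*[n+1]C[k+1]≡[n+1]*nCk zero (suc k) = trans
    (cong (suc (suc k) *_) (k>n⇒nCk≡0 {1} {suc (suc k)} (s<s (s≤s z≤n))))
    (*-zeroʳ (suc (suc k)))
  [k+1]*[n+1]C[k+1]≡[n+1]*nCk (suc n) (suc k) = begin
    suc (suc k) * (suc (suc n) C suc (suc k))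
      ≡⟨ cong (suc (suc k) *_) (nCk+nC[k+1]≡[n+1]C[k+1] (suc n) (suc k)) ⟨
    suc (suc k) * (a + b)
      ≡⟨ solve 3 (λ k a b → (con 1 :+ k) :* (a :+ b) := a :+ k :* a :+ (con 1 :+ k) :* b) refl (suc k) a b ⟩
    a + suc k * a + suc (suc k) * b
      ≡⟨ cong₂ (λ u v → a + u + v)
           ([k+1]*[n+1]C[k+1]≡[n+1]*nCk n k) ([k+1]*[n+1]C[k+1]≡[n+1]*nCk n (suc k)) ⟩
    a + suc n * (n C k) + suc n * (n C suc k)
      ≡⟨ solve 4 (λ a n u v → a :+ n :* u :+ n :* v
                 := a :+ n :* (u :+ v)) refl a (suc n) (n C k) (n C suc k) ⟩
    a + suc n * (n C k + n C suc k)
      ≡⟨ cong (λ u → a + suc n * u) (nCk+nC[k+1]≡[n+1]C[k+1] n k) ⟩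
    suc (suc n) * a ∎
    where
    open ≡-Reasoning
    open +-*-Solver
    a = suc n C suc k
    b = suc n C suc (suc k)

  -- The coefficients of the Lucas polynomials; the first row is that of the
  -- constant 2, so that the recurrence holds from the start.
  lucas : ℕ → ℕ → ℕ
  lucas zero          zero    = 2
  lucas zero          (suc i) = 0
  lucas (suc zero)    zero    = 1
  lucas (suc zero)    (suc i) = 0
  lucas (suc (suc m)) zero    = lucas (suc m) zero
  lucas (suc (suc m)) (suc i) = lucas (suc m) (suc i) + lucas m i

  -- Beyond i = m/2 the exponent `m ∸ 2 * i` is truncated and no longer obeys the expected shifts;
  -- the vanishing coefficient makes such terms harmless.
  m<2i⇒lucas≡0 : ∀ m i → m < 2 * i → lucas m i ≡ 0
  m<2i⇒lucas≡0 zero          (suc i) _   = refl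
  m<2i⇒lucas≡0 (suc zero)    (suc i) _   = refl
  m<2i⇒lucas≡0 (suc (suc m)) (suc i) m<2i = cong₂ _+_
    (m<2i⇒lucas≡0 (suc m) (suc i) (<-trans (n<1+n (suc m)) m<2i))
    (m<2i⇒lucas≡0 m i (≤-pred (≤-pred (subst (suc (suc m) <_) (*-suc 2 i) m<2i))))

  lucas-zero : ∀ m → lucas (suc m) 0 ≡ 1
  lucas-zero zero    = refl
  lucas-zero (suc m) = lucas-zero m

  lucas-diagonal : ∀ i → lucas (suc i) (suc i) ≡ 0
  lucas-diagonal i = m<2i⇒lucas≡0 (suc i) (suc i) (m<m+n (suc i) (s≤s z≤n))

  -- With j = i + 1 and m = k + 1 + j this is C(m-j, j) + C(m-j-1, j-1), the division-free form of
  -- the Dickson coefficient. Both binomials follow Pascal's rule along the recurrence of `lucas`.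
  lucas-suc : ∀ k i → lucas (suc k + suc i) (suc i) ≡ (suc k C suc i) + (k C i)
  lucas-suc k i = trans (cong (λ m → lucas (suc m) (suc i)) (+-suc k i)) (step k i)
    where
    open ≡-Reasoning
    open +-*-Solver
    step : ∀ k i → lucas (suc (k + i)) (suc i) + lucas (k + i) i ≡ (suc k C suc i) + (k C i)
    step zero zero = refl
    step zero (suc i) = begin
      lucas (suc (suc i)) (suc (suc i)) + lucas (suc i) (suc i)
        ≡⟨ cong₂ _+_ (lucas-diagonal (suc i)) (lucas-diagonal i) ⟩
      0
        ≡⟨ cong₂ _+_ (k>n⇒nCk≡0 {1} {suc (suc i)} (s<s (s≤s z≤n))) (k>n⇒nCk≡0 {0} {suc i} (s≤s z≤n)) ⟨
      (1 C suc (suc i)) + (0 C suc i) ∎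
    step (suc k) zero = begin
      lucas (suc (suc (k + 0))) 1 + lucas (suc (k + 0)) 0
        ≡⟨ cong₂ _+_ (step k 0) (lucas-zero (k + 0)) ⟩
      (suc k C 1) + (k C 0) + 1
        ≡⟨ cong (_+ 1) (+-comm (suc k C 1) (k C 0)) ⟩
      (k C 0) + (suc k C 1) + 1
        ≡⟨ cong (_+ 1) (nCk+nC[k+1]≡[n+1]C[k+1] (suc k) 0) ⟩
      (suc (suc k) C 1) + (suc k C 0) ∎
    step (suc k) (suc i) = begin
      lucas (suc (suc (k + suc i))) (suc (suc i)) + lucas (suc k + suc i) (suc i)
        ≡⟨ cong₂ _+_ (step k (suc i)) (lucas-suc k i) ⟩
      a + b + (c + d)
        ≡⟨ solve 4 (λ a b c d → a :+ b :+ (c :+ d) := c :+ a :+ (d :+ b)) refl a b c d ⟩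
      c + a + (d + b)
        ≡⟨ cong₂ _+_ (nCk+nC[k+1]≡[n+1]C[k+1] (suc k) (suc i)) (nCk+nC[k+1]≡[n+1]C[k+1] k i) ⟩
      (suc (suc k) C suc (suc i)) + (suc k C suc i) ∎
      where
      a = suc k C suc (suc i)
      b = k C suc i
      c = suc k C suc i
      d = k C i

  -- Here k stands for m - i, and the quotient is multiplied out. Absorption turns k · C(k-1, i-1)
  -- into i · C(k, i), so the two binomials of `lucas-suc` combine to (k + i) · C(k, i).
  lucas-* : ∀ k i → NonZero (k + i) → i ≤ k → lucas (k + i) i * k ≡ (k + i) * (k C i)
  lucas-* (suc k) zero _ _ = begin
    lucas (suc k + 0) 0 * suc k ≡⟨ cong (_* suc k) (lucas-zero (k + 0)) ⟩
    1 * suc k                   ≡⟨ solve 1 (λ k → con 1 :* k := (k :+ con 0) :* con 1) refl (suc k) ⟩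
    (suc k + 0) * 1             ∎
    where
    open ≡-Reasoning
    open +-*-Solver
  lucas-* (suc k) (suc i) _ _ = begin
    lucas (suc k + suc i) (suc i) * suc k
      ≡⟨ cong (_* suc k) (lucas-suc k i) ⟩
    (a + (k C i)) * suc k
      ≡⟨ solve 3 (λ a b k → (a :+ b) :* k := k :* a :+ k :* b) refl a (k C i) (suc k) ⟩
    suc k * a + suc k * (k C i)
      ≡⟨ cong (suc k * a +_) ([k+1]*[n+1]C[k+1]≡[n+1]*nCk k i) ⟨
    suc k * a + suc i * a
      ≡⟨ *-distribʳ-+ a (suc k) (suc i) ⟨
    (suc k + suc i) * a ∎
    where
    open ≡-Reasoning
    open +-*-Solver
    a = suc k C suc i

  dicksonCoeff≡lucas : ∀ m .{{_ : NonZero m}} (i : Fin (suc ⌊ m /2⌋)) → dicksonCoeff m i ≡ lucas m (toℕ i)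
  dicksonCoeff≡lucas m@(suc _) i = begin
    dicksonCoeff m i              ≡⟨ /-congˡ {{m∸i-nonZero m i}} (sym eq) ⟩
    _/_ (lucas m (toℕ i) * (m ∸ toℕ i)) (m ∸ toℕ i) {{m∸i-nonZero m i}}
      ≡⟨ m*n/n≡m (lucas m (toℕ i)) (m ∸ toℕ i) {{m∸i-nonZero m i}} ⟩
    lucas m (toℕ i)               ∎
    where
    open ≡-Reasoning
    i≤⌊m/2⌋ : toℕ i ≤ ⌊ m /2⌋
    i≤⌊m/2⌋ = Fin.toℕ≤pred[n] i
    k+i≡m : m ∸ toℕ i + toℕ i ≡ m
    k+i≡m = m∸n+n≡m (≤-trans i≤⌊m/2⌋ (⌊n/2⌋≤n m))
    i≤m∸i : toℕ i ≤ m ∸ toℕ i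
    i≤m∸i = m+n≤o⇒m≤o∸n (toℕ i) (≤-trans
      (+-mono-≤ i≤⌊m/2⌋ (≤-trans i≤⌊m/2⌋ (⌊n/2⌋≤⌈n/2⌉ m)))
      (≤-reflexive (⌊n/2⌋+⌈n/2⌉≡n m)))
    eq : lucas m (toℕ i) * (m ∸ toℕ i) ≡ m * ((m ∸ toℕ i) C toℕ i)
    eq = subst (λ z → lucas z (toℕ i) * (m ∸ toℕ i) ≡ z * ((m ∸ toℕ i) C toℕ i)) k+i≡m
      (lucas-* (m ∸ toℕ i) (toℕ i) (subst NonZero (sym k+i≡m) _) i≤m∸i)

-- Finite fields

module _ {a ℓ} (M : CommutativeMonoid a ℓ) where

  open CommutativeMonoid M renaming (_∙_ to _+_; ε to 0#; ∙-congˡ to +-congˡ; identityʳ to +-identityʳ)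
  open MonoidSum M

  sum-single : ∀ {n} (t : Fin n → Carrier) i → (∀ j → j ≢ i → t j ≈ 0#) → sum t ≈ t i
  sum-single {suc n} t i tⱼ≈0 = begin
    sum t                            ≈⟨ sum-remove t ⟩
    t i + sum (λ j → t (punchIn i j))
      ≈⟨ +-congˡ (trans (sum-cong-≋ (λ j → tⱼ≈0 _ (Fin.punchInᵢ≢i i j))) (sum-replicate-zero n)) ⟩
    t i + 0#                         ≈⟨ +-identityʳ _ ⟩
    t i                              ∎
    where open import Relation.Binary.Reasoning.Setoid setoid

module FieldProperties {c ℓ q} (F : FiniteField q c ℓ) where

  open FiniteField F hiding (zero)
  open import Algebra.Properties.Semiring.Exp semiring using (_^_)
  open import Algebra.Properties.Semiring.Mult semiring using () renaming (_×_ to _·_)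
  open import Algebra.Solver.Ring.NaturalCoefficients.Default commutativeSemiring
    using (solve; _:=_; _:+_; _:*_; con)
  open import Relation.Binary.Reasoning.Setoid setoid
  open GroupProperties +-group using (∙-cancelˡ)

  *-cancelˡ-≉0 : ∀ {x y z} → x ≉ 0# → x * y ≈ x * z → y ≈ z
  *-cancelˡ-≉0 {x} {y} {z} x≉0 xy≈xz with x′ , xx′≈1 ← invertible x x≉0 = begin
    y             ≈⟨ unit y ⟩
    x′ * (x * y)  ≈⟨ *-congˡ xy≈xz ⟩
    x′ * (x * z)  ≈⟨ unit z ⟨
    z             ∎
    where
    unit : ∀ w → w ≈ x′ * (x * w)
    unit w = begin
      w             ≈⟨ *-identityˡ w ⟨
      1# * w        ≈⟨ *-congʳ xx′≈1 ⟨
      x * x′ * w    ≈⟨ solve 3 (λ x x′ y → x :* x′ :* y := x′ :* (x :* y)) refl x x′ w ⟩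
      x′ * (x * w)  ∎

  x*y≈0⇒y≈0 : ∀ {x y} → x ≉ 0# → x * y ≈ 0# → y ≈ 0#
  x*y≈0⇒y≈0 {x} x≉0 xy≈0 = *-cancelˡ-≉0 x≉0 (trans xy≈0 (sym (zeroʳ x)))

  x*y≈1⇒x≉0 : ∀ {x y} → x * y ≈ 1# → x ≉ 0#
  x*y≈1⇒x≉0 xy≈1 x≈0 = 0≉1 (trans (sym (trans (*-congʳ x≈0) (zeroˡ _))) xy≈1)

  -- Sums and products over the whole field

  element : Fin q → Carrier
  element = Inverse.from cardinality

  index : Carrier → Fin q
  index = Inverse.to cardinality

  element-index : ∀ x → element (index x) ≈ x
  element-index = Inverse.strictlyInverseʳ cardinality

  element-injective : ∀ {i j} → element i ≈ element j → i ≡ j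
  element-injective {i} {j} eq =
    ≡.trans (≡.sym (Inverse.strictlyInverseˡ cardinality i))
      (≡.trans (Inverse.to-cong cardinality eq) (Inverse.strictlyInverseˡ cardinality j))

  module _ {f g : Carrier → Carrier}
           (f-cong : ∀ {x y} → x ≈ y → f x ≈ f y) (g-cong : ∀ {x y} → x ≈ y → g x ≈ g y)
           (f∘g : ∀ x → f (g x) ≈ x) (g∘f : ∀ x → g (f x) ≈ x) where

    bijection⇒permutation : Permutation q q
    bijection⇒permutation = permutation (index ∘ f ∘ element) (index ∘ g ∘ element)
      (λ i → element-injective (trans (element-index _) (trans (f-cong (element-index _)) (f∘g _))))
      (λ i → element-injective (trans (element-index _) (trans (g-cong (element-index _)) (g∘f _))))

    module _ {a ℓ′} (M : CommutativeMonoid a ℓ′) where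

      private module M = CommutativeMonoid M
      open MonoidSum M using (sum; sum-permute; sum-cong-≋)

      -- The monoid is arbitrary because the result is applied both to addition, for `q·1≈0`, and to
      -- multiplication, for x^q = x.
      sum-reindex : ∀ {h : Carrier → M.Carrier} → (∀ {x y} → x ≈ y → h x M.≈ h y) →
                    sum (λ i → h (element i)) M.≈ sum (λ i → h (f (element i)))
      sum-reindex {h} h-cong = M.trans (sum-permute (λ i → h (element i)) bijection⇒permutation)
        (sum-cong-≋ (λ i → h-cong (element-index (f (element i)))))

  -- Translation by 1 permutes the field, so adding 1 to each of the q summands leaves the sum of
  -- all elements unchanged.
  q·1≈0 : q · 1# ≈ 0#
  q·1≈0 = ∙-cancelˡ (sum element) _ _ $ begin
    sum element + q · 1#          ≈⟨ +-congˡ (sum-replicate q) ⟨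
    sum element + sum {q} (λ _ → 1#)  ≈⟨ ∑-distrib-+ element (λ _ → 1#) ⟨
    sum (λ i → element i + 1#)
      ≈⟨ sum-reindex {_+ 1#} {_- 1#} +-congʳ +-congʳ x-1+1 x+1-1 +-commutativeMonoid (λ e → e) ⟨
    sum element                   ≈⟨ +-identityʳ _ ⟨
    sum element + 0#              ∎
    where
    open MonoidSum +-commutativeMonoid
    x-1+1 : ∀ x → x - 1# + 1# ≈ x
    x-1+1 x = trans (+-assoc _ _ _) (trans (+-congˡ (-‿inverseˡ 1#)) (+-identityʳ x))
    x+1-1 : ∀ x → x + 1# - 1# ≈ x
    x+1-1 x = trans (+-assoc _ _ _) (trans (+-congˡ (-‿inverseʳ 1#)) (+-identityʳ x))

  -- Multiplication by x permutes the nonzero elements.  Products are taken over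
  -- the whole field, with 0 replaced by 1; the factor x this misses at 0 is
  -- supplied by correction.
  module _ {x} (x≉0 : x ≉ 0#) where

    private
      open MonoidSum *-commutativeMonoid using ()
        renaming (sum to product; ∑-distrib-+ to product-distrib-*;
                  sum-cong-≋ to product-cong; sum-replicate to product-replicate)

      unit : Carrier → Carrier
      unit y with y ≟ 0#
      ... | yes _ = 1#
      ... | no  _ = y

      correction : Carrier → Carrier
      correction y with y ≟ 0#
      ... | yes _ = x
      ... | no  _ = 1#

      unit-cong : ∀ {y z} → y ≈ z → unit y ≈ unit z
      unit-cong {y} {z} y≈z with y ≟ 0# | z ≟ 0#
      ... | yes _   | yes _   = refl
      ... | yes y≈0 | no  z≉0 = contradiction (trans (sym y≈z) y≈0) z≉0
      ... | no  y≉0 | yes z≈0 = contradiction (trans y≈z z≈0) y≉0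
      ... | no  _   | no  _   = y≈z

      unit≉0 : ∀ y → unit y ≉ 0#
      unit≉0 y with y ≟ 0#
      ... | yes _   = 0≉1 ∘ sym
      ... | no  y≉0 = y≉0

      unit-* : ∀ y → unit (x * y) * correction y ≈ x * unit y
      unit-* y with y ≟ 0# | x * y ≟ 0#
      ... | yes _   | yes _    = *-comm 1# x
      ... | yes y≈0 | no  xy≉0 = contradiction (trans (*-congˡ y≈0) (zeroʳ x)) xy≉0
      ... | no  y≉0 | yes xy≈0 = contradiction (x*y≈0⇒y≈0 x≉0 xy≈0) y≉0
      ... | no  _   | no  _    = *-identityʳ _

      product≉0 : ∀ {n} (t : Fin n → Carrier) → (∀ i → t i ≉ 0#) → product t ≉ 0#
      product≉0 {zero}  t t≉0 = 0≉1 ∘ sym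
      product≉0 {suc n} t t≉0 eq = product≉0 (t ∘ suc) (t≉0 ∘ suc) (x*y≈0⇒y≈0 (t≉0 zero) eq)

      correction-0 : ∀ {y} → y ≈ 0# → correction y ≈ x
      correction-0 {y} y≈0 with y ≟ 0#
      ... | yes _   = refl
      ... | no  y≉0 = contradiction y≈0 y≉0

      correction-≉0 : ∀ {y} → y ≉ 0# → correction y ≈ 1#
      correction-≉0 {y} y≉0 with y ≟ 0#
      ... | yes y≈0 = contradiction y≈0 y≉0
      ... | no  _   = refl

      units : Fin q → Carrier
      units i = unit (element i)

      x⁻¹ = inv x x≉0

      x*x⁻¹*y : ∀ y → x * (x⁻¹ * y) ≈ y
      x*x⁻¹*y y = trans (sym (*-assoc x x⁻¹ y)) (trans (*-congʳ (proj₂ (invertible x x≉0))) (*-identityˡ y))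

      x⁻¹*x*y : ∀ y → x⁻¹ * (x * y) ≈ y
      x⁻¹*x*y y = trans (solve 3 (λ x x′ y → x′ :* (x :* y) := x :* (x′ :* y)) refl x x⁻¹ y) (x*x⁻¹*y y)

    x≉0⇒x^q≈x : x ^ q ≈ x
    x≉0⇒x^q≈x = *-cancelˡ-≉0 (product≉0 units (unit≉0 ∘ element)) $ begin
      product units * x ^ q
        ≈⟨ *-comm _ _ ⟩
      x ^ q * product units
        ≈⟨ *-congʳ (product-replicate q) ⟨
      product {q} (λ _ → x) * product units
        ≈⟨ product-distrib-* (λ _ → x) units ⟨
      product (λ i → x * units i)
        ≈⟨ product-cong (λ i → unit-* (element i)) ⟨
      product (λ i → unit (x * element i) * correction (element i))
        ≈⟨ product-distrib-* (λ i → unit (x * element i)) (correction ∘ element) ⟩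
      product (λ i → unit (x * element i)) * product (correction ∘ element)
        ≈⟨ *-cong (sym (sum-reindex *-congˡ *-congˡ x*x⁻¹*y x⁻¹*x*y *-commutativeMonoid unit-cong))
                  (sum-single *-commutativeMonoid (correction ∘ element) (index 0#) λ i i≢0 →
                     correction-≉0 λ eᵢ≈0 → i≢0 (element-injective (trans eᵢ≈0 (sym (element-index 0#))))) ⟩
      product units * correction (element (index 0#))
        ≈⟨ *-congˡ (correction-0 (element-index 0#)) ⟩
      product units * x
        ∎

  x^q≈x : ∀ x → x ^ q ≈ x
  x^q≈x x with x ≟ 0#
  ... | no  x≉0 = x≉0⇒x^q≈x x≉0
  ... | yes x≈0 = trans (x^n≈0 q (index 0#)) (sym x≈0)
    where
    x^n≈0 : ∀ n → Fin n → x ^ n ≈ 0#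
    x^n≈0 (suc n) _ = trans (*-congʳ x≈0) (zeroˡ _)

  -- Polynomial functions and the number of their roots

  -- Polynomial k d f: f is a polynomial function of degree at most d in which
  -- x ^ d has the coefficient k, expressed through iterated division by x - a.
  Polynomial : Carrier → ℕ → (Carrier → Carrier) → Set (c ⊔ ℓ)
  Polynomial k zero    f = ∀ x → f x ≈ k
  Polynomial k (suc d) f = ∀ a → ∃[ g ] Polynomial k d g × (∀ x → f x ≈ f a + (x - a) * g x)

  polynomial-cong : ∀ {k l} d {f g} → k ≈ l → (∀ x → f x ≈ g x) → Polynomial k d f → Polynomial l d g
  polynomial-cong zero    k≈l f≈g f≈k = λ x → trans (sym (f≈g x)) (trans (f≈k x) k≈l)
  polynomial-cong (suc d) k≈l f≈g p a with h , ph , eq ← p a =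
    h , polynomial-cong d k≈l (λ _ → refl) ph ,
    λ x → trans (sym (f≈g x)) (trans (eq x) (+-congʳ (f≈g a)))

  polynomial-+ : ∀ {k l} d {f g} → Polynomial k d f → Polynomial l d g →
                 Polynomial (k + l) d (λ x → f x + g x)
  polynomial-+ zero    f≈k g≈l = λ x → +-cong (f≈k x) (g≈l x)
  polynomial-+ (suc d) {f} {g} p r a with f′ , pf′ , eqf ← p a | g′ , pg′ , eqg ← r a =
    (λ x → f′ x + g′ x) , polynomial-+ d pf′ pg′ , λ x → trans (+-cong (eqf x) (eqg x))
      (solve 5 (λ fa ga e u v → fa :+ e :* u :+ (ga :+ e :* v)
               := fa :+ ga :+ e :* (u :+ v)) refl (f a) (g a) (x - a) (f′ x) (g′ x))

  polynomial-scale : ∀ {l} d k {f} → Polynomial l d f → Polynomial (k * l) d (λ x → k * f x)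
  polynomial-scale zero    k f≈l = λ x → *-congˡ (f≈l x)
  polynomial-scale (suc d) k {f} p a with f′ , pf′ , eqf ← p a =
    (λ x → k * f′ x) , polynomial-scale d k pf′ , λ x → trans (*-congˡ (eqf x))
      (solve 4 (λ k fa e u → k :* (fa :+ e :* u) := k :* fa :+ e :* (k :* u)) refl k (f a) (x - a) (f′ x))

  polynomial-suc : ∀ {k} d {f} → Polynomial k d f → Polynomial 0# (suc d) f
  polynomial-suc zero    {f} f≈k a =
    (λ _ → 0#) , (λ _ → refl) , λ x → trans (f≈k x) (trans (sym (f≈k a))
      (solve 2 (λ fa e → fa := fa :+ e :* con 0) refl (f a) (x - a)))
  polynomial-suc (suc d) p a with f′ , pf′ , eqf ← p a = f′ , polynomial-suc d pf′ , eqf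

  polynomial-< : ∀ {k d e f} → d ℕ.< e → Polynomial k d f → Polynomial 0# e f
  polynomial-< {d = d} d<e p = go (ℕ.≤⇒≤′ d<e)
    where
    go : ∀ {e} → suc d ℕ.≤′ e → Polynomial 0# e _
    go (ℕ.≤′-reflexive ≡.refl) = polynomial-suc d p
    go (ℕ.≤′-step {n = e} lt) = polynomial-suc e (go lt)

  -- Dividing f g by x - a leaves the quotient f′ g + f(a) g′. Its first summand carries the leading
  -- coefficient by induction on d; the second has too small a degree to contribute to it.
  polynomial-* : ∀ {k l} d e {f g} → Polynomial k d f → Polynomial l e g →
                 Polynomial (k * l) (d ℕ.+ e) (λ x → f x * g x)
  polynomial-* {k} zero e f≈k r =
    polynomial-cong e refl (λ x → *-congʳ (sym (f≈k x))) (polynomial-scale e k r)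
  polynomial-* {k} {l} (suc d) e {f} {g} p r a with f′ , pf′ , eqf ← p a | low e r
    where
    low : ∀ e → Polynomial l e g → ∃[ g′ ] Polynomial 0# (d ℕ.+ e) g′ × (∀ x → g x ≈ g a + (x - a) * g′ x)
    -- A constant g has quotient 0. It is raised one degree at a time, since for d = 0 the target
    -- degree is again 0 and `polynomial-<` would demand a strict increase.
    low zero    r with g′ , pg′ , eqg ← polynomial-suc 0 r a = g′ , weaken d pg′ , eqg
      where
      weaken : ∀ d → Polynomial 0# 0 g′ → Polynomial 0# (d ℕ.+ 0) g′
      weaken zero    s = s
      weaken (suc d) s = polynomial-suc (d ℕ.+ 0) (weaken d s)
    low (suc e) r with g′ , pg′ , eqg ← r a = g′ , polynomial-< (ℕ.m≤n+m (suc e) d) pg′ , eqg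
  ... | g′ , pg′ , eqg =
    (λ x → f′ x * g x + f a * g′ x) ,
    polynomial-cong (d ℕ.+ e) (trans (+-congˡ (zeroʳ _)) (+-identityʳ _)) (λ _ → refl)
      (polynomial-+ (d ℕ.+ e) (polynomial-* d e pf′ r) (polynomial-scale (d ℕ.+ e) (f a) pg′)) ,
    λ x → begin
      f x * g x                                     ≈⟨ *-congʳ (eqf x) ⟩
      (f a + (x - a) * f′ x) * g x
        ≈⟨ solve 4 (λ fa e u gx → (fa :+ e :* u) :* gx
                   := fa :* gx :+ e :* (u :* gx)) refl (f a) (x - a) (f′ x) (g x) ⟩
      f a * g x + (x - a) * (f′ x * g x)            ≈⟨ +-congʳ (*-congˡ (eqg x)) ⟩
      f a * (g a + (x - a) * g′ x) + (x - a) * (f′ x * g x)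
        ≈⟨ solve 5 (λ fa ga e v w → fa :* (ga :+ e :* v) :+ e :* w
                   := fa :* ga :+ e :* (w :+ fa :* v)) refl (f a) (g a) (x - a) (g′ x) (f′ x * g x) ⟩
      f a * g a + (x - a) * (f′ x * g x + f a * g′ x) ∎

  polynomial-^ : ∀ d → Polynomial 1# d (_^ d)
  polynomial-^ zero    = λ _ → refl
  polynomial-^ (suc d) =
    polynomial-cong (suc d) (*-identityˡ 1#) (λ _ → refl) (polynomial-* 1 d polynomial-id (polynomial-^ d))
    where
    polynomial-id : Polynomial 1# 1 (λ x → x)
    polynomial-id a = (λ _ → 1#) , (λ _ → refl) , λ x → begin
      x                  ≈⟨ +-identityʳ x ⟨
      x + 0#             ≈⟨ +-congˡ (-‿inverseˡ a) ⟨
      x + (- a + a)      ≈⟨ solve 3 (λ x a′ a → x :+ (a′ :+ a) := a :+ (x :+ a′) :* con 1) refl x (- a) a ⟩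
      a + (x - a) * 1#   ∎

  -- Division at the first root keeps the leading coefficient, and the quotient vanishes at all the
  -- remaining roots because they differ from the first.
  degree<#roots : ∀ {k} d {f} → k ≉ 0# → Polynomial k d f → (t : Fin (suc d) → Carrier) →
    (∀ {i j} → t i ≈ t j → i ≡ j) → ¬ (∀ i → f (t i) ≈ 0#)
  degree<#roots zero    k≉0 f≈k t t-inj f≈0 = k≉0 (trans (sym (f≈k (t zero))) (f≈0 zero))
  degree<#roots (suc d) {f} k≉0 p t t-inj f≈0 with g , pg , eq ← p (t zero) =
    degree<#roots d k≉0 pg (t ∘ suc) (Fin.suc-injective ∘ t-inj) λ i → x*y≈0⇒y≈0 (tᵢ-t₀≉0 i) $ begin
      (t (suc i) - t zero) * g (t (suc i))               ≈⟨ +-identityˡ _ ⟨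
      0# + (t (suc i) - t zero) * g (t (suc i))          ≈⟨ +-congʳ (f≈0 zero) ⟨
      f (t zero) + (t (suc i) - t zero) * g (t (suc i))  ≈⟨ eq (t (suc i)) ⟨
      f (t (suc i))                                      ≈⟨ f≈0 (suc i) ⟩
      0#                                                 ∎
    where
    open GroupProperties +-group using (x∙y⁻¹≈ε⇒x≈y)
    tᵢ-t₀≉0 : ∀ i → t (suc i) - t zero ≉ 0#
    tᵢ-t₀≉0 i eq with () ← t-inj (x∙y⁻¹≈ε⇒x≈y _ _ eq)

  -- The field itself supplies the d + 1 distinct points. Equality being decidable, a search through
  -- them turns "not all are roots" into a witness.
  ∃-nonroot : ∀ {k d f} → k ≉ 0# → Polynomial k d f → suc d ≡ q → ∃[ x ] f x ≉ 0#
  ∃-nonroot {d = d} {f} k≉0 p 1+d≡q =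
    let i , fᵢ≉0 = Fin.¬∀⟶∃¬ (suc d) _ (λ i → f (t i) ≟ 0#) (degree<#roots d k≉0 p t t-injective)
    in t i , fᵢ≉0
    where
    t : Fin (suc d) → Carrier
    t i = element (cast 1+d≡q i)
    t-injective : ∀ {i j} → t i ≈ t j → i ≡ j
    t-injective {i} {j} eq = Fin.toℕ-injective $ ≡.trans (≡.sym (Fin.toℕ-cast 1+d≡q i))
      (≡.trans (≡.cong toℕ (element-injective eq)) (Fin.toℕ-cast 1+d≡q j))

-- Arithmetic in characteristic 2

HasCharacteristic2 : ∀ {c ℓ q} → FiniteField q c ℓ → Set ℓ
HasCharacteristic2 F = 1# + 1# ≈ 0#
  where open FiniteField F

module Characteristic2 {c ℓ q} (F : FiniteField q c ℓ)
  (1+1≈0 : HasCharacteristic2 F) where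

  open FiniteField F hiding (zero)
  open FieldProperties F
  open import Algebra.Properties.Semiring.Exp semiring using (_^_; ^-homo-*; ^-congˡ)
  open import Algebra.Properties.Semiring.Mult semiring using (×-homo-+; ×-comm-*; ×-congʳ) renaming (_×_ to _·_)
  open import Relation.Binary.Reasoning.Setoid setoid
  open GroupProperties +-group using (inverseˡ-unique; ε⁻¹≈ε)
  open SemiringSum semiring
    using (sum; sum-cong-≋; sum-init-last; ∑-distrib-+; *-distribˡ-sum; sum-replicate-zero)

  -1≈1 : - 1# ≈ 1#
  -1≈1 = sym (inverseˡ-unique 1# 1# 1+1≈0)

  -- With coefficients in the prime field, the ring solver also cancels x + x.
  private
    module 𝔽₂ = CommutativeRing Bool.xor-∧-commutativeRing

    embed : Bool → Carrier
    embed b = if b then 1# else 0#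

    embed-homo : 𝔽₂.rawRing -Raw-AlmostCommutative⟶ fromCommutativeRing commutativeRing
    embed-homo = record
      { ⟦_⟧    = embed
      ; +-homo = λ where
          false b     → sym (+-identityˡ (embed b))
          true  false → sym (+-identityʳ 1#)
          true  true  → sym 1+1≈0
      ; *-homo = λ where
          false b → sym (zeroˡ (embed b))
          true  b → sym (*-identityˡ (embed b))
      ; -‿homo = λ where
          false → sym ε⁻¹≈ε
          true  → sym -1≈1
      ; 0-homo = refl
      ; 1-homo = refl
      }

    embed-≟ : WeaklyDecidable (λ a b → embed a ≈ embed b)
    embed-≟ false false = just refl
    embed-≟ true  true  = just refl
    embed-≟ _     _     = nothing

  open RingSolver 𝔽₂.rawRing (fromCommutativeRing commutativeRing) embed-homo embed-≟
    using (solve; _:=_; _:+_; _:*_; con) public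

  x+x≈0 : ∀ x → x + x ≈ 0#
  x+x≈0 x = solve 1 (λ x → x :+ x := con false) refl x

  x+y≈0⇒y≈x : ∀ {x y} → x + y ≈ 0# → y ≈ x
  x+y≈0⇒y≈x {x} {y} x+y≈0 = begin
    y            ≈⟨ solve 2 (λ x y → y := x :+ (x :+ y)) refl x y ⟩
    x + (x + y)  ≈⟨ +-congˡ x+y≈0 ⟩
    x + 0#       ≈⟨ +-identityʳ x ⟩
    x            ∎

  x*x≈x⇒x≈0⊎x≈1 : ∀ {x} → x * x ≈ x → x ≈ 0# ⊎ x ≈ 1#
  x*x≈x⇒x≈0⊎x≈1 {x} xx≈x with x ≟ 0#
  ... | yes x≈0 = inj₁ x≈0
  ... | no  x≉0 = inj₂ (*-cancelˡ-≉0 x≉0 (trans xx≈x (sym (*-identityʳ x))))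

  ^-2^suc : ∀ x k → x ^ (2 ℕ.^ suc k) ≈ x ^ (2 ℕ.^ k) * x ^ (2 ℕ.^ k)
  ^-2^suc x k = trans (^-homo-* x (2 ℕ.^ k) (2 ℕ.^ k ℕ.+ 0))
    (*-congˡ (reflexive (≡.cong (x ^_) (ℕ.+-identityʳ (2 ℕ.^ k)))))

  ^-2^-+ : ∀ x y k → (x + y) ^ (2 ℕ.^ k) ≈ x ^ (2 ℕ.^ k) + y ^ (2 ℕ.^ k)
  ^-2^-+ x y zero    = distribʳ 1# x y
  ^-2^-+ x y (suc k) = begin
    (x + y) ^ (2 ℕ.^ suc k)                        ≈⟨ ^-2^suc (x + y) k ⟩
    (x + y) ^ (2 ℕ.^ k) * (x + y) ^ (2 ℕ.^ k)      ≈⟨ *-cong (^-2^-+ x y k) (^-2^-+ x y k) ⟩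
    (x′ + y′) * (x′ + y′)
      ≈⟨ solve 2 (λ x y → (x :+ y) :* (x :+ y) := x :* x :+ y :* y) refl x′ y′ ⟩
    x′ * x′ + y′ * y′                              ≈⟨ +-cong (^-2^suc x k) (^-2^suc y k) ⟨
    x ^ (2 ℕ.^ suc k) + y ^ (2 ℕ.^ suc k)          ∎
    where
    x′ = x ^ (2 ℕ.^ k)
    y′ = y ^ (2 ℕ.^ k)

  *-^-2^≈1 : ∀ {x y} k → x * y ≈ 1# → x ^ (2 ℕ.^ k) * y ^ (2 ℕ.^ k) ≈ 1#
  *-^-2^≈1 {x} {y} zero    xy≈1 = trans (*-cong (*-identityʳ x) (*-identityʳ y)) xy≈1
  *-^-2^≈1 {x} {y} (suc k) xy≈1 = begin
    x ^ (2 ℕ.^ suc k) * y ^ (2 ℕ.^ suc k)  ≈⟨ *-cong (^-2^suc x k) (^-2^suc y k) ⟩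
    x′ * x′ * (y′ * y′)
      ≈⟨ solve 2 (λ x y → x :* x :* (y :* y) := x :* y :* (x :* y)) refl x′ y′ ⟩
    x′ * y′ * (x′ * y′)                    ≈⟨ *-cong (*-^-2^≈1 k xy≈1) (*-^-2^≈1 k xy≈1) ⟩
    1# * 1#                                ≈⟨ *-identityˡ 1# ⟩
    1#                                     ∎
    where
    x′ = x ^ (2 ℕ.^ k)
    y′ = y ^ (2 ℕ.^ k)

  -- The trace

  Tr-cong : ∀ k {x y} → x ≈ y → Tr F k x ≈ Tr F k y
  Tr-cong k x≈y = sum-cong-≋ {k} λ j → ^-congˡ (2 ℕ.^ toℕ j) x≈y

  Tr-suc : ∀ k x → Tr F (suc k) x ≈ Tr F k x + x ^ (2 ℕ.^ k)
  Tr-suc k x = trans (sum-init-last {k} λ j → x ^ (2 ℕ.^ toℕ j)) $ +-cong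
    (sum-cong-≋ {k} λ j → reflexive (≡.cong (λ i → x ^ (2 ℕ.^ i)) (Fin.toℕ-inject₁ j)))
    (reflexive (≡.cong (λ i → x ^ (2 ℕ.^ i)) (Fin.toℕ-fromℕ k)))

  Tr-+ : ∀ k x y → Tr F k (x + y) ≈ Tr F k x + Tr F k y
  Tr-+ k x y = trans (sum-cong-≋ {k} λ j → ^-2^-+ x y (toℕ j))
    (∑-distrib-+ {k} (λ j → x ^ (2 ℕ.^ toℕ j)) (λ j → y ^ (2 ℕ.^ toℕ j)))

  Tr-0 : ∀ k → Tr F k 0# ≈ 0#
  Tr-0 k = trans (Tr-cong k (sym (x+x≈0 0#))) (trans (Tr-+ k 0# 0#) (x+x≈0 (Tr F k 0#)))

  Tr-² : ∀ k x → Tr F k (x * x) ≈ Tr F k x * Tr F k x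
  Tr-² zero    x = sym (zeroˡ 0#)
  Tr-² (suc k) x = begin
    Tr F (suc k) (x * x)                        ≈⟨ Tr-suc k (x * x) ⟩
    Tr F k (x * x) + (x * x) ^ (2 ℕ.^ k)        ≈⟨ +-cong (Tr-² k x) (^-distrib-* x x (2 ℕ.^ k)) ⟩
    T * T + x′ * x′
      ≈⟨ solve 2 (λ x y → x :* x :+ y :* y := (x :+ y) :* (x :+ y)) refl T x′ ⟩
    (T + x′) * (T + x′)                         ≈⟨ *-cong (Tr-suc k x) (Tr-suc k x) ⟨
    Tr F (suc k) x * Tr F (suc k) x             ∎
    where
    open import Algebra.Properties.CommutativeSemiring.Exp commutativeSemiring using (^-distrib-*)
    T  = Tr F k x
    x′ = x ^ (2 ℕ.^ k)

  -- Splits off the first power of x, where `Tr-suc` splits off the last: the remaining powers are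
  -- the squares of those in `Tr F k x`. Comparing both at k = n, where x^q = x, gives T² = T.
  Tr-suc-² : ∀ k x → Tr F (suc k) x ≈ Tr F k x * Tr F k x + x
  Tr-suc-² zero    x = solve 1 (λ x → x :* con true :+ con false := con false :* con false :+ x) refl x
  Tr-suc-² (suc k) x = begin
    Tr F (suc (suc k)) x             ≈⟨ Tr-suc (suc k) x ⟩
    Tr F (suc k) x + x ^ (2 ℕ.^ suc k)  ≈⟨ +-cong (Tr-suc-² k x) (^-2^suc x k) ⟩
    T * T + x + x′ * x′
      ≈⟨ solve 3 (λ t x y → t :* t :+ x :+ y :* y := (t :+ y) :* (t :+ y) :+ x) refl T x x′ ⟩
    (T + x′) * (T + x′) + x          ≈⟨ +-congʳ (*-cong (Tr-suc k x) (Tr-suc k x)) ⟨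
    Tr F (suc k) x * Tr F (suc k) x + x ∎
    where
    T  = Tr F k x
    x′ = x ^ (2 ℕ.^ k)

  -- Additive Hilbert 90: the root is Σ_{j<n} Tr_j(u) t^(2^j) for any t of trace 1.
  module _ (t u : Carrier) where

    private
      w : ℕ → Carrier
      w zero    = 0#
      w (suc k) = w k + Tr F k u * t ^ (2 ℕ.^ k)

      -- As Tr_{j+1}(u) = Tr_j(u)² + u, squaring moves the j-th summand of w to the next one, up to
      -- u · t^(2^(j+1)). In w² + w all summands then cancel but the one of index k, and the
      -- corrections add up to u · Tr_k(t)².
      w²+w : ∀ k → w k * w k + w k ≈ Tr F k u * t ^ (2 ℕ.^ k) + u * (Tr F k t * Tr F k t)
      w²+w zero =
        solve 2 (λ t u → con false :* con false :+ con false
                := con false :* (t :* con true) :+ u :* (con false :* con false)) refl t u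
      w²+w (suc k) = begin
        (w k + s * t′) * (w k + s * t′) + (w k + s * t′)
          ≈⟨ solve 3 (λ w s t → (w :+ s :* t) :* (w :+ s :* t) :+ (w :+ s :* t)
                     := (w :* w :+ w) :+ (s :* t :+ s :* s :* (t :* t))) refl (w k) s t′ ⟩
        (w k * w k + w k) + (s * t′ + s * s * (t′ * t′))
          ≈⟨ +-congʳ (w²+w k) ⟩
        (s * t′ + u * (T * T)) + (s * t′ + s * s * (t′ * t′))
          ≈⟨ solve 4 (λ s t u T → (s :* t :+ u :* (T :* T)) :+ (s :* t :+ s :* s :* (t :* t))
                     := (s :* s :+ u) :* (t :* t) :+ u :* ((T :+ t) :* (T :+ t))) refl s t′ u T ⟩
        (s * s + u) * (t′ * t′) + u * ((T + t′) * (T + t′))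
          ≈⟨ +-cong (*-cong (Tr-suc-² k u) (^-2^suc t k)) (*-congˡ (*-cong (Tr-suc k t) (Tr-suc k t))) ⟨
        Tr F (suc k) u * t ^ (2 ℕ.^ suc k) + u * (Tr F (suc k) t * Tr F (suc k) t) ∎
        where
        s  = Tr F k u
        T  = Tr F k t
        t′ = t ^ (2 ℕ.^ k)

    Tr≈0⇒∃z²+z : ∀ n → Tr F n t ≈ 1# → Tr F n u ≈ 0# → ∃[ z ] z * z + z ≈ u
    Tr≈0⇒∃z²+z n Trt≈1 Tru≈0 = w n , (begin
      w n * w n + w n                                       ≈⟨ w²+w n ⟩
      Tr F n u * t ^ (2 ℕ.^ n) + u * (Tr F n t * Tr F n t)
        ≈⟨ +-cong (*-congʳ Tru≈0) (*-congˡ (*-cong Trt≈1 Trt≈1)) ⟩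
      0# * t ^ (2 ℕ.^ n) + u * (1# * 1#)
        ≈⟨ solve 2 (λ t u → con false :* t :+ u :* (con true :* con true) := u) refl (t ^ (2 ℕ.^ n)) u ⟩
      u ∎)

  -- Dickson polynomials

  -- V x m is D_m(x); in characteristic 2, D_0 = 2 is 0 and signs disappear.
  V : Carrier → ℕ → Carrier
  V x zero          = 0#
  V x (suc zero)    = x
  V x (suc (suc m)) = x * V x (suc m) + V x m

  private
    lucasTerm : Carrier → ℕ → ℕ → Carrier
    lucasTerm x m i = lucas m i · x ^ (m ℕ.∸ 2 ℕ.* i)

    lucasSum : Carrier → ℕ → ℕ → Carrier
    lucasSum x m N = sum {N} (λ i → lucasTerm x m (toℕ i))

    lucasTerm-suc : ∀ x m i →
      lucasTerm x (suc (suc m)) (suc i) ≈ x * lucasTerm x (suc m) (suc i) + lucasTerm x m i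
    lucasTerm-suc x m i rewrite ℕ.+-suc i (i ℕ.+ 0) = begin
      (a ℕ.+ b) · y              ≈⟨ ×-homo-+ y a b ⟩
      a · y + b · y              ≈⟨ +-congʳ shift ⟩
      x * (a · x ^ (m ℕ.∸ suc (2 ℕ.* i))) + b · y ∎
      where
      a = lucas (suc m) (suc i)
      b = lucas m i
      y = x ^ (m ℕ.∸ 2 ℕ.* i)
      shift : a · y ≈ x * (a · x ^ (m ℕ.∸ suc (2 ℕ.* i)))
      -- If m ≤ 2i, the truncated exponents no longer differ by one, so a factor x cannot be moved;
      -- but then the coefficient `a` is 0.
      shift with ℕ.≤-<-connex (suc (2 ℕ.* i)) m
      ... | inj₁ 2i<m = begin
        a · y
          ≈⟨ ×-congʳ a (reflexive (≡.cong (x ^_) (ℕ.+-∸-assoc 1 2i<m))) ⟩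
        a · (x * x ^ (m ℕ.∸ suc (2 ℕ.* i)))
          ≈⟨ ×-comm-* a x _ ⟨
        x * (a · x ^ (m ℕ.∸ suc (2 ℕ.* i))) ∎
      ... | inj₂ m<1+2i
        rewrite m<2i⇒lucas≡0 (suc m) (suc i) (≡.subst (suc m ℕ.<_) (≡.sym (ℕ.*-suc 2 i)) (ℕ.s<s m<1+2i))
        = sym (zeroʳ x)

    lucasSum-suc : ∀ x m N →
      lucasSum x (suc (suc m)) (suc N) ≈ x * lucasSum x (suc m) (suc N) + lucasSum x m N
    lucasSum-suc x m N = begin
      h′ + sum {N} (λ i → lucasTerm x (suc (suc m)) (suc (toℕ i)))
        ≈⟨ +-cong (sym (×-comm-* (lucas (suc m) 0) x (x ^ suc m)))
                  (sum-cong-≋ {N} λ i → lucasTerm-suc x m (toℕ i)) ⟩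
      x * h + sum {N} (λ i → x * s (toℕ i) + lucasTerm x m (toℕ i))
        ≈⟨ +-congˡ (∑-distrib-+ {N} (λ i → x * s (toℕ i)) (λ i → lucasTerm x m (toℕ i))) ⟩
      x * h + (sum {N} (λ i → x * s (toℕ i)) + lucasSum x m N)
        ≈⟨ +-congˡ (+-congʳ (*-distribˡ-sum {N} x (λ i → s (toℕ i)))) ⟨
      x * h + (x * sum {N} (λ i → s (toℕ i)) + lucasSum x m N)
        ≈⟨ solve 4 (λ x h s t → x :* h :+ (x :* s :+ t)
                   := x :* (h :+ s) :+ t) refl x h (sum {N} (λ i → s (toℕ i))) (lucasSum x m N) ⟩
      x * (h + sum {N} (λ i → s (toℕ i))) + lucasSum x m N ∎
      where
      h′ = lucasTerm x (suc (suc m)) 0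
      h = lucasTerm x (suc m) 0
      s : ℕ → Carrier
      s i = lucasTerm x (suc m) (suc i)

    -- The number of terms is left free above ⌊m/2⌋: the recurrence needs the sum for m + 1 with as
    -- many terms as the one for m + 2, which may be one more than it has nonzero coefficients.
    lucasSum≈V : ∀ x m N → ⌊ m /2⌋ ℕ.< N → lucasSum x m N ≈ V x m
    lucasSum≈V x zero (suc N) _ = begin
      1# + (1# + 0#) + sum {N} (λ _ → 0#)  ≈⟨ +-congˡ (sum-replicate-zero N) ⟩
      1# + (1# + 0#) + 0#
        ≈⟨ solve 0 (con true :+ (con true :+ con false) :+ con false := con false) refl ⟩
      0#                                   ∎
    lucasSum≈V x (suc zero) (suc N) _ = begin
      x * 1# + 0# + sum {N} (λ _ → 0#)     ≈⟨ +-congˡ (sum-replicate-zero N) ⟩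
      x * 1# + 0# + 0#
        ≈⟨ solve 1 (λ x → x :* con true :+ con false :+ con false := x) refl x ⟩
      x                                    ∎
    lucasSum≈V x (suc (suc m)) (suc N) m/2<N = trans (lucasSum-suc x m N) $ +-cong
      (*-congˡ (lucasSum≈V x (suc m) (suc N) (ℕ.≤-<-trans (ℕ.⌊n/2⌋-mono (ℕ.n≤1+n (suc m))) m/2<N)))
      (lucasSum≈V x m N (ℕ.s<s⁻¹ m/2<N))

  D≈V : ∀ m .{{_ : NonZero m}} x → D F m x ≈ V x m
  D≈V m x = trans (sum-cong-≋ term) (lucasSum≈V x m (suc ⌊ m /2⌋) ℕ.≤-refl)
    where
    [-1]^i≈1 : ∀ i → (- 1#) ^ i ≈ 1#
    [-1]^i≈1 zero    = refl
    [-1]^i≈1 (suc i) = trans (*-cong -1≈1 ([-1]^i≈1 i)) (*-identityˡ 1#)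
    term : ∀ (i : Fin (suc ⌊ m /2⌋)) →
      dicksonCoeff m i · ((- 1#) ^ toℕ i * x ^ (m ℕ.∸ 2 ℕ.* toℕ i)) ≈ lucasTerm x m (toℕ i)
    term i rewrite dicksonCoeff≡lucas m i =
      ×-congʳ (lucas m (toℕ i)) (trans (*-congʳ ([-1]^i≈1 (toℕ i))) (*-identityˡ _))

  -- For x = u + 1/u this is the expansion of (u^(k+m) + u^-(k+m)) (u^k + u^-k). Such a u may lie
  -- outside the field, so the proof runs along the recurrence instead. The induction lowers k and
  -- raises m with k + m fixed, which keeps the left factor the same throughout.
  V-* : ∀ x k m → V x (k ℕ.+ m) * V x k ≈ V x (k ℕ.+ (k ℕ.+ m)) + V x m
  V-* x zero m = solve 1 (λ v → v :* con false := v :+ v) refl (V x m)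
  V-* x (suc zero) m = solve 3 (λ x u v → u :* x := (x :* u :+ v) :+ v) refl x (V x (suc m)) (V x m)
  V-* x (suc (suc k)) m = begin
    v * (x * V x (suc k) + V x k)
      ≈⟨ solve 4 (λ v x a b → v :* (x :* a :+ b) := x :* (v :* a) :+ v :* b) refl v x (V x (suc k)) (V x k) ⟩
    x * (v * V x (suc k)) + v * V x k
      ≈⟨ +-cong (*-congˡ (*-congʳ (V-index eq₁))) (*-congʳ (V-index eq₂)) ⟩
    x * (V x (suc k ℕ.+ suc m) * V x (suc k)) + V x (k ℕ.+ suc (suc m)) * V x k
      ≈⟨ +-cong (*-congˡ (V-* x (suc k) (suc m))) (V-* x k (suc (suc m))) ⟩
    x * (V x (suc k ℕ.+ (suc k ℕ.+ suc m)) + V x (suc m))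
      + (V x (k ℕ.+ (k ℕ.+ suc (suc m))) + V x (suc (suc m)))
      ≈⟨ +-cong (*-congˡ (+-congʳ (V-index (≡.cong (suc k ℕ.+_) (≡.sym eq₁)))))
                (+-congʳ (V-index (≡.cong (k ℕ.+_) (≡.sym eq₂)))) ⟩
    x * (V x (suc k ℕ.+ (suc (suc k) ℕ.+ m)) + V x (suc m))
      + (V x (k ℕ.+ (suc (suc k) ℕ.+ m)) + (x * V x (suc m) + V x m))
      ≈⟨ solve 5 (λ x a b c d → x :* (a :+ b) :+ (c :+ (x :* b :+ d)) := (x :* a :+ c) :+ d) refl
           x (V x (suc k ℕ.+ (suc (suc k) ℕ.+ m))) (V x (suc m)) (V x (k ℕ.+ (suc (suc k) ℕ.+ m))) (V x m) ⟩
    V x (suc (suc k) ℕ.+ (suc (suc k) ℕ.+ m)) + V x m ∎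
    where
    v = V x (suc (suc k) ℕ.+ m)
    V-index : ∀ {i j} → i ≡ j → V x i ≈ V x j
    V-index i≡j = reflexive (≡.cong (V x) i≡j)
    eq₁ : suc (suc k) ℕ.+ m ≡ suc k ℕ.+ suc m
    eq₁ = ≡.cong suc (≡.sym (ℕ.+-suc k m))
    eq₂ : suc (suc k) ℕ.+ m ≡ k ℕ.+ suc (suc m)
    eq₂ = ≡.trans eq₁ (≡.sym (ℕ.+-suc k (suc m)))

  V-2^ : ∀ x k → V x (2 ℕ.^ k) ≈ x ^ (2 ℕ.^ k)
  V-2^ x zero    = sym (*-identityʳ x)
  V-2^ x (suc k) = begin
    V x (2 ℕ.^ suc k)                        ≈⟨ +-identityʳ _ ⟨
    V x (2 ℕ.^ suc k) + 0#                   ≈⟨ V-* x (2 ℕ.^ k) 0 ⟨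
    V x (2 ℕ.^ k ℕ.+ 0) * V x (2 ℕ.^ k)      ≈⟨ *-congʳ (reflexive (≡.cong (V x) (ℕ.+-identityʳ (2 ℕ.^ k)))) ⟩
    V x (2 ℕ.^ k) * V x (2 ℕ.^ k)            ≈⟨ *-cong (V-2^ x k) (V-2^ x k) ⟩
    x ^ (2 ℕ.^ k) * x ^ (2 ℕ.^ k)            ≈⟨ ^-2^suc x k ⟨
    x ^ (2 ℕ.^ suc k)                        ∎

  V-1+2^suc : ∀ x k → V x (suc (2 ℕ.^ suc k)) ≈ x ^ (2 ℕ.^ k) * V x (suc (2 ℕ.^ k)) + x
  V-1+2^suc x k = begin
    V x (suc (p ℕ.+ (p ℕ.+ 0)))          ≈⟨ reflexive (≡.cong (V x) 1+2p≡p+p+1) ⟩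
    V x (p ℕ.+ (p ℕ.+ 1))
      ≈⟨ solve 2 (λ u x → u := u :+ x :+ x) refl (V x (p ℕ.+ (p ℕ.+ 1))) x ⟩
    V x (p ℕ.+ (p ℕ.+ 1)) + x + x        ≈⟨ +-congʳ (V-* x p 1) ⟨
    V x (p ℕ.+ 1) * V x p + x
      ≈⟨ +-congʳ (*-cong (reflexive (≡.cong (V x) (ℕ.+-comm p 1))) (V-2^ x k)) ⟩
    V x (suc p) * x ^ p + x              ≈⟨ +-congʳ (*-comm _ _) ⟩
    x ^ p * V x (suc p) + x              ∎
    where
    p = 2 ℕ.^ k
    1+2p≡p+p+1 : suc (p ℕ.+ (p ℕ.+ 0)) ≡ p ℕ.+ (p ℕ.+ 1)
    1+2p≡p+p+1 = ≡.trans (≡.sym (ℕ.+-suc p (p ℕ.+ 0))) (≡.cong (p ℕ.+_) (≡.sym (ℕ.+-suc p 0)))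

  -- Divide `V-1+2^suc` by x^(2^(k+1)) · x: the quotient of D_{2^k+1} by x^(2^k) · x starts at 1 for
  -- k = 0 and gains y^(2^(k+1)) at each step. The powers gained, from y² to y^(2^k), sum to
  -- Tr_k(y)².
  V-1+2^ : ∀ {x y} → x * y ≈ 1# → ∀ k → V x (suc (2 ℕ.^ k)) ≈ x ^ (2 ℕ.^ k) * x * (1# + Tr F k y * Tr F k y)
  V-1+2^ {x} xy≈1 zero =
    solve 1 (λ x → x :* x :+ con false := x :* con true :* x :* (con true :+ con false :* con false)) refl x
  V-1+2^ {x} {y} xy≈1 (suc k) = begin
    V x (suc (2 ℕ.^ suc k))                ≈⟨ V-1+2^suc x k ⟩
    x′ * V x (suc (2 ℕ.^ k)) + x           ≈⟨ +-congʳ (*-congˡ (V-1+2^ xy≈1 k)) ⟩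
    x′ * (x′ * x * (1# + T * T)) + x       ≈⟨ +-congˡ (*-identityʳ x) ⟨
    x′ * (x′ * x * (1# + T * T)) + x * 1#  ≈⟨ +-congˡ (*-congˡ (*-^-2^≈1 (suc k) xy≈1)) ⟨
    x′ * (x′ * x * (1# + T * T)) + x * (x ^ (2 ℕ.^ suc k) * y ^ (2 ℕ.^ suc k))
      ≈⟨ +-congˡ (*-congˡ (*-cong (^-2^suc x k) (^-2^suc y k))) ⟩
    x′ * (x′ * x * (1# + T * T)) + x * (x′ * x′ * (y′ * y′))
      ≈⟨ solve 4 (λ x x′ y′ T → x′ :* (x′ :* x :* (con true :+ T :* T)) :+ x :* (x′ :* x′ :* (y′ :* y′))
                 := x′ :* x′ :* x :* (con true :+ (T :+ y′) :* (T :+ y′))) refl x x′ y′ T ⟩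
    x′ * x′ * x * (1# + (T + y′) * (T + y′))
      ≈⟨ *-cong (*-congʳ (^-2^suc x k)) (+-congˡ (*-cong (Tr-suc k y) (Tr-suc k y))) ⟨
    x ^ (2 ℕ.^ suc k) * x * (1# + Tr F (suc k) y * Tr F (suc k) y) ∎
    where
    x′ = x ^ (2 ℕ.^ k)
    y′ = y ^ (2 ℕ.^ k)
    T  = Tr F k y

-- Leaves and elements of trace one

module _ {c ℓ} n (F : FiniteField (2 ℕ.^ n) c ℓ) where

  open FiniteField F hiding (zero)
  open FieldProperties F
  open import Algebra.Properties.Semiring.Mult semiring using (×1-homo-*) renaming (_×_ to _·_)

  -- If 1 + 1 were nonzero, so would be its n-th power, which is q · 1.
  characteristic2 : HasCharacteristic2 F
  characteristic2 = decidable-stable (1# + 1# ≟ 0#) λ 1+1≉0 → 2^k·1≉0 1+1≉0 n q·1≈0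
    where
    2^k·1≉0 : 1# + 1# ≉ 0# → ∀ k → (2 ℕ.^ k) · 1# ≉ 0#
    2^k·1≉0 1+1≉0 zero    eq = 0≉1 (sym (trans (sym (+-identityʳ 1#)) eq))
    2^k·1≉0 1+1≉0 (suc k) eq = 2^k·1≉0 1+1≉0 k
      (x*y≈0⇒y≈0 (1+1≉0 ∘ trans (+-congˡ (sym (+-identityʳ 1#)))) (trans (sym (×1-homo-* 2 (2 ℕ.^ k))) eq))

module BinaryField {c ℓ} n (F : FiniteField (2 ℕ.^ n) c ℓ) where

  private
    q = 2 ℕ.^ n

  open FiniteField F hiding (zero)
  open FieldProperties F
  open Characteristic2 F (characteristic2 n F)
  open PointEquality _≈_ using (_≈∙_; ∙≈∙; [_]; ≈∙-trans)
  open import Algebra.Properties.Semiring.Exp semiring using (_^_)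
  open import Relation.Binary.Reasoning.Setoid setoid

  Tr-idem : ∀ x → Tr F n x * Tr F n x ≈ Tr F n x
  Tr-idem x = begin
    T * T          ≈⟨ solve 2 (λ t x → t :* t := t :* t :+ x :+ x) refl T x ⟩
    T * T + x + x  ≈⟨ +-congʳ (Tr-suc-² n x) ⟨
    Tr F (suc n) x + x  ≈⟨ +-congʳ (Tr-suc n x) ⟩
    T + x ^ q + x  ≈⟨ +-congʳ (+-congˡ (x^q≈x x)) ⟩
    T + x + x      ≈⟨ solve 2 (λ t x → t :+ x :+ x := t) refl T x ⟩
    T              ∎
    where T = Tr F n x

  Tr≉0⇒Tr≈1 : ∀ x → Tr F n x ≉ 0# → Tr F n x ≈ 1#
  Tr≉0⇒Tr≈1 x Tr≉0 with x*x≈x⇒x≈0⊎x≈1 {Tr F n x} (Tr-idem x)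
  ... | inj₁ Tr≈0 = contradiction Tr≈0 Tr≉0
  ... | inj₂ Tr≈1 = Tr≈1

  Tr[z²+z]≈0 : ∀ z → Tr F n (z * z + z) ≈ 0#
  Tr[z²+z]≈0 z = begin
    Tr F n (z * z + z)           ≈⟨ Tr-+ n (z * z) z ⟩
    Tr F n (z * z) + Tr F n z    ≈⟨ +-congʳ (Tr-² n z) ⟩
    Tr F n z * Tr F n z + Tr F n z ≈⟨ +-congʳ (Tr-idem z) ⟩
    Tr F n z + Tr F n z          ≈⟨ x+x≈0 (Tr F n z) ⟩
    0#                           ∎

  module _ {x y} (xy≈1 : x * y ≈ 1#) where

    D≈x²[1+Tr] : D F (suc q) x ≈ x * x * (1# + Tr F n y)
    D≈x²[1+Tr] = begin
      D F (suc q) x                             ≈⟨ D≈V (suc q) x ⟩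
      V x (suc q)                               ≈⟨ V-1+2^ xy≈1 n ⟩
      x ^ q * x * (1# + Tr F n y * Tr F n y)    ≈⟨ *-cong (*-congʳ (x^q≈x x)) (+-congˡ (Tr-idem y)) ⟩
      x * x * (1# + Tr F n y)                   ∎

    Tr≈1⇒D≈0 : Tr F n y ≈ 1# → D F (suc q) x ≈ 0#
    Tr≈1⇒D≈0 Tr≈1 = begin
      D F (suc q) x            ≈⟨ D≈x²[1+Tr] ⟩
      x * x * (1# + Tr F n y)  ≈⟨ *-congˡ (+-congˡ Tr≈1) ⟩
      x * x * (1# + 1#)        ≈⟨ solve 1 (λ x → x :* x :* (con true :+ con true) := con false) refl x ⟩
      0#                       ∎

    D≈0⇒Tr≈1 : D F (suc q) x ≈ 0# → Tr F n y ≈ 1#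
    D≈0⇒Tr≈1 D≈0 = x+y≈0⇒y≈x (x*y≈0⇒y≈0 x≉0 (x*y≈0⇒y≈0 x≉0
      (trans (sym (*-assoc x x _)) (trans (sym D≈x²[1+Tr]) D≈0))))
      where
      x≉0 = x*y≈1⇒x≉0 xy≈1

    θ-invertible : θ F [ x ] ≈∙ [ x + y ]
    θ-invertible with x ≟ 0#
    ... | yes x≈0 = contradiction x≈0 (x*y≈1⇒x≉0 xy≈1)
    ... | no  x≉0 = [ +-congˡ (*-cancelˡ-≉0 x≉0 (trans (proj₂ (invertible x x≉0)) (sym xy≈1))) ]

    -- The easy direction: a preimage β gives z = β y with z² + z = y², whose left side has trace 0
    -- and whose right side has trace 1. The equation follows on writing the linear term as z · 1
    -- with 1 = x y = (β + 1/β) y.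
    Tr≈1⇒Leaf : Tr F n y ≈ 1# → Leaf F [ x ]
    Tr≈1⇒Leaf Tr≈1 ([ β ] , θβ≈x) with β ≟ 0#
    Tr≈1⇒Leaf Tr≈1 ([ β ] , ()) | yes _
    Tr≈1⇒Leaf Tr≈1 ([ β ] , [ β+γ≈x ]) | no β≉0 = 0≉1 $ begin
      0#                               ≈⟨ Tr[z²+z]≈0 (β * y) ⟨
      Tr F n (β * y * (β * y) + β * y) ≈⟨ Tr-cong n z²+z≈y² ⟩
      Tr F n (y * y)                   ≈⟨ Tr-² n y ⟩
      Tr F n y * Tr F n y              ≈⟨ *-cong Tr≈1 Tr≈1 ⟩
      1# * 1#                          ≈⟨ *-identityˡ 1# ⟩
      1#                               ∎
      where
      γ = inv β β≉0
      z²+z≈y² : β * y * (β * y) + β * y ≈ y * y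
      z²+z≈y² = begin
        β * y * (β * y) + β * y             ≈⟨ +-congˡ (*-identityʳ _) ⟨
        β * y * (β * y) + β * y * 1#        ≈⟨ +-congˡ (*-congˡ (trans (*-congʳ β+γ≈x) xy≈1)) ⟨
        β * y * (β * y) + β * y * ((β + γ) * y)
          ≈⟨ solve 3 (λ β γ y → β :* y :* (β :* y) :+ β :* y :* ((β :+ γ) :* y)
                     := β :* γ :* (y :* y)) refl β γ y ⟩
        β * γ * (y * y)                     ≈⟨ *-congʳ (proj₂ (invertible β β≉0)) ⟩
        1# * (y * y)                        ≈⟨ *-identityˡ _ ⟩
        y * y                               ∎

  -- Were the trace of y equal to 0, so would be that of y², and Hilbert 90 would solve z² + z = y²
  -- and produce a preimage of x. The element `t` of trace 1 is a parameter because its existence is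
  -- a separate matter, settled by counting roots.
  Leaf⇒Tr≈1 : ∀ t {x y} → Tr F n t ≈ 1# → x * y ≈ 1# → Leaf F [ x ] → Tr F n y ≈ 1#
  Leaf⇒Tr≈1 t {x} {y} Trt≈1 xy≈1 leaf = Tr≉0⇒Tr≈1 y λ Try≈0 →
    let z , z²+z≈y² = Tr≈0⇒∃z²+z t (y * y) n Trt≈1 (trans (Tr-² n y) (trans (*-congʳ Try≈0) (zeroˡ _)))
        -- This reverses the substitution z = β/x. The inverse of β is β + x, so θ(β) = β + (β + x)
        -- = x.
        β = x * z
        β[β+x]≈1 = begin
          x * z * (x * z + x)
            ≈⟨ solve 2 (λ x z → x :* z :* (x :* z :+ x) := x :* x :* (z :* z :+ z)) refl x z ⟩
          x * x * (z * z + z)    ≈⟨ *-congˡ z²+z≈y² ⟩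
          x * x * (y * y)        ≈⟨ solve 2 (λ x y → x :* x :* (y :* y) := x :* y :* (x :* y)) refl x y ⟩
          x * y * (x * y)        ≈⟨ *-cong xy≈1 xy≈1 ⟩
          1# * 1#                ≈⟨ *-identityˡ 1# ⟩
          1#                     ∎
    in leaf ([ β ] , ≈∙-trans trans (θ-invertible β[β+x]≈1)
                       [ solve 2 (λ b x → b :+ (b :+ x) := x) refl β x ])

  -- In characteristic 2, θ(1) = 1 + 1 = 0.
  Leaf⇒≉0 : ∀ {x} → Leaf F [ x ] → x ≉ 0#
  Leaf⇒≉0 leaf x≈0 = leaf
    ([ 1# ] , ≈∙-trans trans (θ-invertible (*-identityˡ 1#)) [ trans (x+x≈0 1#) (sym x≈0) ])

  L-satisfiable : ∃[ x ] ∃[ y ] x * y ≈ 1# × Tr F n x ≈ 1# × Tr F n y ≈ 1# → Satisfiable (L F n)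
  L-satisfiable (x , y , xy≈1 , Trx≈1 , Try≈1) =
    [ x ] , Tr≈1⇒Leaf xy≈1 Try≈1 , inj₂ (x≉0 , trans Trx≈1 (sym (trans (Tr-cong n x⁻¹≈y) Try≈1)))
    where
    x≉0 = x*y≈1⇒x≉0 xy≈1
    x⁻¹≈y : inv x x≉0 ≈ y
    x⁻¹≈y = *-cancelˡ-≉0 x≉0 (trans (proj₂ (invertible x x≉0)) (sym xy≈1))

  S≐L : ∀ t → Tr F n t ≈ 1# → S F (suc q) ≐ L F n
  S≐L t Trt≈1 = (λ {α} → S⊆L α) , (λ {α} → L⊆S α)
    where
    S⊆L : ∀ α → S F (suc q) α → L F n α
    S⊆L [ x ] (x≉0 , Dx≈0 , Dx⁻¹≈0) = Tr≈1⇒Leaf xx⁻¹≈1 Trx⁻¹≈1 ,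
      inj₂ (x≉0 , trans (D≈0⇒Tr≈1 (trans (*-comm _ x) xx⁻¹≈1) Dx⁻¹≈0) (sym Trx⁻¹≈1))
      where
      xx⁻¹≈1 = proj₂ (invertible x x≉0)
      Trx⁻¹≈1 = D≈0⇒Tr≈1 xx⁻¹≈1 Dx≈0

    L⊆S : ∀ α → L F n α → S F (suc q) α
    L⊆S ∙     (leaf , _) = contradiction (∙ , ∙≈∙) leaf
    L⊆S [ x ] (leaf , inj₁ x≈0) = contradiction x≈0 (Leaf⇒≉0 leaf)
    L⊆S [ x ] (leaf , inj₂ (x≉0 , Trx≈Trx⁻¹)) =
      x≉0 , Tr≈1⇒D≈0 xx⁻¹≈1 Trx⁻¹≈1 , Tr≈1⇒D≈0 (trans (*-comm _ x) xx⁻¹≈1) (trans Trx≈Trx⁻¹ Trx⁻¹≈1)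
      where
      xx⁻¹≈1 = proj₂ (invertible x x≉0)
      Trx⁻¹≈1 = Leaf⇒Tr≈1 t Trt≈1 xx⁻¹≈1 leaf

-- An element whose trace and whose inverse's trace are both 1

module _ {c ℓ} n′ (F : FiniteField (2 ℕ.^ suc n′) c ℓ) where

  private
    n = suc n′

  open FiniteField F hiding (zero)
  open FieldProperties F
  open Characteristic2 F (characteristic2 n F)
  open import Algebra.Properties.Semiring.Exp semiring using (_^_)
  open import Relation.Binary.Reasoning.Setoid setoid
  open BinaryField n F

  private
    -- This is 2^k - 1, written as the sum that `polynomial-*` produces for `reversedTr`, so that
    -- the degrees agree by definition.
    degree : ℕ → ℕ
    degree zero    = 0
    degree (suc k) = 2 ℕ.^ k ℕ.+ degree k

    1+degree : ∀ k → suc (degree k) ≡ 2 ℕ.^ k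
    1+degree zero    = ≡.refl
    1+degree (suc k) = ≡.trans (≡.sym (ℕ.+-suc (2 ℕ.^ k) (degree k)))
      (≡.cong (2 ℕ.^ k ℕ.+_) (≡.trans (1+degree k) (≡.sym (ℕ.+-identityʳ (2 ℕ.^ k)))))

    -- At k = n - 1 this is x^(q/2) Tr_n(1/x), written as a polynomial.
    reversedTr : ℕ → Carrier → Carrier
    reversedTr zero    x = 1#
    reversedTr (suc k) x = x ^ (2 ℕ.^ k) * reversedTr k x + 1#

    reversedTr≈ : ∀ {x y} → x * y ≈ 1# → ∀ k → reversedTr k x ≈ x ^ (2 ℕ.^ k) * Tr F (suc k) y
    reversedTr≈ {x} {y} xy≈1 zero = begin
      1#                            ≈⟨ xy≈1 ⟨
      x * y
        ≈⟨ solve 2 (λ x y → x :* y := x :* con true :* (y :* con true :+ con false)) refl x y ⟩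
      x * 1# * (y * 1# + 0#)        ∎
    reversedTr≈ {x} {y} xy≈1 (suc k) = begin
      x′ * reversedTr k x + 1#
        ≈⟨ +-cong (*-congˡ (reversedTr≈ xy≈1 k)) (sym (*-^-2^≈1 (suc k) xy≈1)) ⟩
      x′ * (x′ * T) + x″ * y″             ≈⟨ +-congʳ (*-assoc x′ x′ T) ⟨
      x′ * x′ * T + x″ * y″               ≈⟨ +-congʳ (*-congʳ (^-2^suc x k)) ⟨
      x″ * T + x″ * y″                    ≈⟨ distribˡ x″ T y″ ⟨
      x″ * (T + y″)                       ≈⟨ *-congˡ (Tr-suc (suc k) y) ⟨
      x″ * Tr F (suc (suc k)) y           ∎
      where
      x′ = x ^ (2 ℕ.^ k)
      x″ = x ^ (2 ℕ.^ suc k)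
      y″ = y ^ (2 ℕ.^ suc k)
      T  = Tr F (suc k) y

    polynomial-1 : Polynomial 1# 0 (λ _ → 1#)
    polynomial-1 _ = refl

    reversedTr-polynomial : ∀ k → Polynomial 1# (degree k) (reversedTr k)
    reversedTr-polynomial zero    = polynomial-1
    reversedTr-polynomial (suc k) =
      polynomial-cong (degree (suc k)) (trans (+-identityʳ _) (*-identityˡ 1#)) (λ _ → refl) $
      polynomial-+ (degree (suc k))
        (polynomial-* (2 ℕ.^ k) (degree k) (polynomial-^ (2 ℕ.^ k)) (reversedTr-polynomial k))
        (polynomial-< (ℕ.≤-trans (ℕ.m^n>0 2 k) (ℕ.m≤m+n (2 ℕ.^ k) (degree k))) polynomial-1)

    Tr-polynomial : ∀ k → Polynomial 1# (2 ℕ.^ k) (Tr F (suc k))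
    Tr-polynomial k =
      polynomial-cong (2 ℕ.^ k) (+-identityˡ 1#) (λ x → sym (Tr-suc k x)) $
      polynomial-+ (2 ℕ.^ k) (low k) (polynomial-^ (2 ℕ.^ k))
      where
      low : ∀ k → Polynomial 0# (2 ℕ.^ k) (Tr F k)
      low zero    = polynomial-suc {0#} 0 (λ _ → refl)
      low (suc k) = polynomial-< (ℕ.^-monoʳ-< 2 (ℕ.n<1+n 1) (ℕ.n<1+n k)) (Tr-polynomial k)

  -- A nonzero value of the product forces both traces to be nonzero, hence 1. The point 0 is ruled
  -- out by the factor `Tr`, not by `reversedTr`, which takes the value 1 there.
  ∃-Tr≈1 : ∃[ x ] ∃[ y ] x * y ≈ 1# × Tr F n x ≈ 1# × Tr F n y ≈ 1#
  ∃-Tr≈1 with x , Px≉0 ← ∃-nonroot (0≉1 ∘ sym ∘ trans (sym (*-identityˡ 1#)))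
        (polynomial-* (2 ℕ.^ n′) (degree n′) (Tr-polynomial n′) (reversedTr-polynomial n′)) (1+degree n)
    = x , inv x x≉0 , proj₂ (invertible x x≉0) , Tr≉0⇒Tr≈1 x Trx≉0 , Tr≉0⇒Tr≈1 (inv x x≉0) Try≉0
    where
    Trx≉0 : Tr F n x ≉ 0#
    Trx≉0 Tr≈0 = Px≉0 (trans (*-congʳ Tr≈0) (zeroˡ _))
    x≉0 : x ≉ 0#
    x≉0 x≈0 = Trx≉0 (trans (Tr-cong n x≈0) (Tr-0 n))
    Try≉0 : Tr F n (inv x x≉0) ≉ 0#
    Try≉0 Tr≈0 = Px≉0 $ begin
      Tr F n x * reversedTr n′ x   ≈⟨ *-congˡ (reversedTr≈ (proj₂ (invertible x x≉0)) n′) ⟩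
      Tr F n x * (x ^ (2 ℕ.^ n′) * Tr F n (inv x x≉0)) ≈⟨ *-congˡ (*-congˡ Tr≈0) ⟩
      Tr F n x * (x ^ (2 ℕ.^ n′) * 0#)
        ≈⟨ solve 2 (λ t u → t :* (u :* con false) := con false) refl (Tr F n x) (x ^ (2 ℕ.^ n′)) ⟩
      0# ∎

open import Data.Nat.Base using (_^_; _≤_)

lemma4p14 : ∀ {c ℓ} (n : ℕ) → 1 ≤ n → (F : FiniteField (2 ^ n) c ℓ) →
    Satisfiable (L F n) × (S F (suc (2 ^ n)) ≐ L F n)
lemma4p14 (suc n) _ F =
  let t , _ , _ , Trt≈1 , _ = ∃-Tr≈1 n F
  in L-satisfiable (∃-Tr≈1 n F) , S≐L t Trt≈1
  where open BinaryField (suc n) F
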